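{- There are absolute constants $\gamma>0$ and $C_0\ge 1$ such that for every integer $k>5$ the following holds. For every (deterministic) terminal-cuts scheme for $k$-terminal networks whose edge costs are integers in $\{1,\dots,n^{C_0}\}$ (where $n$ is the number of vertices), there exists such a $k$-terminal network $(G,c)$ on which the memory $M=P(G,c)$ produced by preprocessing occupies at least $2^{\gamma k}$ machine words, where a machine word consists of $\lceil\log_2 n\rceil$ bits.
   Context: A $k$-terminal network $(G,c)$ is an undirected graph $G$ with edge costs $c$ and a set $Q\subseteq V(G)$ of $k$ terminals. For $S\subset Q$, $S\ne\emptyset,Q$, $\bar S=Q\setminus S$, and $\mathrm{mincut}_{G,c}(S,\bar S)$ is the minimum total cost of the set of edges crossing a cut $(W,V(G)\setminus W)$ with $W\cap Q\in\{S,\bar S\}$. A terminal-cuts (TC) scheme consists of a preprocessing map $P$ that maps each $k$-terminal network $(G,c)$ (with the stated edge costs) to a memory image $M$ (a bit string), and a query map $Q(\cdot\,;\cdot)$ that, given $S\subset Q$ and $M$ only (without access to $(G,c)$), outputs a value, such that $Q(S;P(G,c))=\mathrm{mincut}_{G,c}(S,\bar S)$ for all networks and all $S\subset Q$, $S\neq\emptyset,Q$. Storage is measured in machine words of $\Theta(\log n)$ bits. -}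

module Defs where

open import Data.Bool.Base using (Bool; if_then_else_; _xor_)
open import Data.Fin.Base using (Fin; _<_)
open import Data.Fin.Subset using (Subset; ⊤; ⊥; ∁)
open import Data.Integer.Base using (∣_∣)
open import Data.List.Base using (List; length)
open import Data.Nat.Base using (ℕ; _≤_; _*_; _^_)
open import Data.Nat.Logarithm using (⌈log₂_⌉)
open import Data.Nat.Properties using (+-0-commutativeMonoid)
open import Data.Product.Base using (_×_; proj₁; proj₂; ∃-syntax)
open import Data.Rational.Base using (ℚ; ↥_; ↧ₙ_)
open import Data.Sum.Base using (_⊎_)
open import Data.Vec.Base using (lookup; tabulate)
open import Function.Definitions using (Injective)
open import Relation.Binary.PropositionalEquality.Core using (_≡_; _≢_)
open import Algebra.Properties.CommutativeMonoid.Sum +-0-commutativeMonoid using (sum)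

-- A finite simple undirected graph.  An edge {u , v} is recorded once, with its
-- smaller endpoint first: this rules out loops, and injectivity rules out
-- parallel edges.
record Graph : Set where
  field
    #vertices      : ℕ
    #edges         : ℕ
    endpoints      : Fin #edges → Fin #vertices × Fin #vertices
    ordered        : ∀ e → proj₁ (endpoints e) < proj₂ (endpoints e)
    endpoints-inj  : Injective _≡_ _≡_ endpoints

-- The terminals are named by Fin k, and `terminal` says which vertex carries
-- each name.  A set of terminals can thus be given to a query as a Subset k,
-- which reveals nothing about the network.
record Network (k C₀ : ℕ) : Set where
  field
    graph : Graph
  open Graph graph public
  field
    cost         : Fin #edges → ℕ
    cost-lower   : ∀ e → 1 ≤ cost e
    cost-upper   : ∀ e → cost e ≤ #vertices ^ C₀
    terminal     : Fin k → Fin #vertices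
    terminal-inj : Injective _≡_ _≡_ terminal

module _ {k C₀ : ℕ} (N : Network k C₀) where
  open Network N

  crosses : Subset #vertices → Fin #edges → Bool
  crosses W e = lookup W (proj₁ (endpoints e)) xor lookup W (proj₂ (endpoints e))

  cutCost : Subset #vertices → ℕ
  cutCost W = sum λ e → if crosses W e then cost e else 0

  -- W ∩ Q, in terms of terminal names.
  terminalsIn : Subset #vertices → Subset k
  terminalsIn W = tabulate λ i → lookup W (terminal i)

  Separates : Subset #vertices → Subset k → Set
  Separates W S = terminalsIn W ≡ S ⊎ terminalsIn W ≡ ∁ S

  IsMinCut : Subset k → ℕ → Set
  IsMinCut S v = (∃[ W ] Separates W S × cutCost W ≡ v)
               × (∀ W → Separates W S → v ≤ cutCost W)

Memory : Set
Memory = List Bool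

record TCScheme (k C₀ : ℕ) : Set where
  field
    preprocess : Network k C₀ → Memory
    query      : Subset k → Memory → ℕ
    correct    : ∀ N S → S ≢ ⊥ → S ≢ ⊤ → IsMinCut N S (query S (preprocess N))

wordSize : ∀ {k C₀} → Network k C₀ → ℕ
wordSize N = ⌈log₂ Network.#vertices N ⌉

-- For γ = p / q ≥ 0, this says 2^(γ k) · w ≤ |M|, where w is the number of bits
-- in a word; both sides are raised to the power q to avoid irrational numbers.
MemoryAtLeast : ℚ → (k w : ℕ) → Memory → Set
MemoryAtLeast γ k w M = 2 ^ (∣ ↥ γ ∣ * k) * w ^ (↧ₙ γ) ≤ length M ^ (↧ₙ γ)

{-# OPTIONS --safe #-}

-- Write k = 2 + m and split the terminals into two special ones and m ordinary
-- ones.  For every U ⊆ Fin m there is a star whose centre is joined to all the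
-- terminals, with weights such that, when the second special terminal and V are
-- separated from the rest, the optimal side of the centre pays for the edge to
-- the first special terminal exactly when U ⊆ V.  A free perturbation x_U of the
-- cost of that edge thus enters the minimum cuts as Σ_{U ⊆ V} x_U, up to terms
-- not depending on x, so the minimum cuts determine all of the 2 ^ m numbers
-- x_U, by induction on |U|.  Each of them ranges over n values, so by the
-- pigeonhole principle some memory has at least 2 ^ m · log₂ n bits.
module Submission where

open import Defs
open import Data.Nat.Base using (ℕ; _≤_; _>_)
open import Data.Product.Base using (_×_; ∃-syntax)
open import Data.Rational.Base as ℚ using (ℚ; 0ℚ)
open import Data.Bool.Base using (Bool; true; false; not; if_then_else_; _xor_)
open import Data.Bool.Properties using (not-distribˡ-xor; not-distribʳ-xor)
open import Data.Fin.Base as Fin using (Fin; zero; suc; toℕ; fromℕ<; _↑ˡ_; _↑ʳ_; combine; remQuot; finToFun; punchIn)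
open import Data.Fin.Properties as Fin using (any?; pigeonhole; 2↔Bool; remQuot-combine; combine-remQuot; toℕ-↑ˡ; toℕ-↑ʳ; ↑ˡ-injective; ↑ʳ-injective; toℕ<n; toℕ-injective; punchInᵢ≢i; fromℕ<-injective)
open import Data.Fin.Subset using (Subset; _⊆_; ∁; inside; outside) renaming (∣_∣ to size)
open import Data.Fin.Subset.Properties using (_⊆?_; ⊆-refl; out⊆; in⊆in; drop-∷-⊆; p⊆q⇒∣p∣≤∣q∣)
import Data.Integer.Base as ℤ
open import Data.List.Base using (List; []; _∷_; length)
open import Data.Nat.Base using (zero; suc; _+_; _*_; _^_; _∸_; _<_; _⊓_; z≤n; s≤s; z<s; s<s)
open import Data.Nat.Induction using (<-wellFounded; Acc; acc)
open import Data.Nat.Logarithm using (⌈log₂_⌉; ⌈log₂2^n⌉≡n)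
open import Data.Nat.Properties as ℕ using (+-0-commutativeMonoid; ≤-refl; ≤-trans; ≤-reflexive; ≤-antisym; +-mono-≤)
open import Data.Nat.Tactic.RingSolver using (solve-∀)
open import Data.Product.Base using (_,_; proj₁; proj₂; uncurry)
open import Data.Product.Properties using (,-injectiveˡ; ,-injectiveʳ)
open import Data.Sum.Base using (inj₁; inj₂)
open import Data.Vec.Base using ([]; _∷_; _++_; lookup; tabulate; replicate; here)
open import Data.Vec.Properties using (lookup-map; lookup∘tabulate; tabulate∘lookup; tabulate-cong; lookup-++ˡ; lookup-++ʳ)
open import Function.Base using (_∘_)
open import Function.Bundles using (Injection; Inverse)
open import Function.Properties.Inverse using (↔⇒↣)
open import Relation.Binary.PropositionalEquality.Core using (_≡_; _≢_; refl; sym; trans; cong; cong₂; subst)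
open import Relation.Binary.PropositionalEquality.Properties using (module ≡-Reasoning)
open import Relation.Nullary using (¬_; yes; no; contradiction)

open import Algebra.Properties.CommutativeMonoid.Sum +-0-commutativeMonoid using (sum; sum-remove; ∑-distrib-+; sum-cong-≗)

-- Finite sums.

sum-mono-≤ : ∀ {n} {f g : Fin n → ℕ} → (∀ i → f i ≤ g i) → sum f ≤ sum g
sum-mono-≤ {zero}  f≤g = z≤n
sum-mono-≤ {suc n} f≤g = +-mono-≤ (f≤g zero) (sum-mono-≤ (f≤g ∘ suc))

sum-≤-* : ∀ {n b} {f : Fin n → ℕ} → (∀ i → f i ≤ b) → sum f ≤ n * b
sum-≤-* {zero}  f≤b = z≤n
sum-≤-* {suc n} f≤b = +-mono-≤ (f≤b zero) (sum-≤-* (f≤b ∘ suc))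

sum-↑ : ∀ m {n} (f : Fin (m + n) → ℕ) → sum f ≡ sum (f ∘ (_↑ˡ n)) + sum (f ∘ (m ↑ʳ_))
sum-↑ zero    f = refl
sum-↑ (suc m) f = trans (cong (f zero +_) (sum-↑ m (f ∘ suc))) (sym (ℕ.+-assoc (f zero) _ _))

sum-combine : ∀ m {n} (f : Fin (m * n) → ℕ) → sum f ≡ sum (λ (i : Fin m) → sum (λ (j : Fin n) → f (combine i j)))
sum-combine zero        f = refl
sum-combine (suc m) {n} f = trans (sum-↑ n f) (cong (sum (f ∘ (_↑ˡ m * n)) +_) (sum-combine m (f ∘ (n ↑ʳ_))))

-- Isolates the contribution of one star once all the other stars are known to contribute equally.
sum-cancel-except : ∀ {n} (f g : Fin n → ℕ) i → (∀ j → j ≢ i → f j ≡ g j) → sum f ≡ sum g → f i ≡ g i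
sum-cancel-except {suc n} f g i f≡g Σf≡Σg = ℕ.+-cancelʳ-≡ (sum (f ∘ punchIn i)) (f i) (g i) (begin
  f i + sum (f ∘ punchIn i) ≡⟨ sum-remove f ⟨
  sum f                     ≡⟨ Σf≡Σg ⟩
  sum g                     ≡⟨ sum-remove g ⟩
  g i + sum (g ∘ punchIn i) ≡⟨ cong (g i +_) (sum-cong-≗ (λ j → f≡g _ (punchInᵢ≢i i j))) ⟨
  g i + sum (f ∘ punchIn i) ∎)
  where open ≡-Reasoning

-- Injective encodings and counting bit strings.

remQuot-injective : ∀ m n {i j : Fin (m * n)} → remQuot {m} n i ≡ remQuot n j → i ≡ j
remQuot-injective m n {i} {j} eq = begin
  i                                 ≡⟨ combine-remQuot {m} n i ⟨
  uncurry combine (remQuot {m} n i) ≡⟨ cong (uncurry combine) eq ⟩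
  uncurry combine (remQuot {m} n j) ≡⟨ combine-remQuot {m} n j ⟩
  j                                 ∎
  where open ≡-Reasoning

finToFun-injective : ∀ {m} n {i j : Fin (m ^ n)} → (∀ l → finToFun {m} {n} i l ≡ finToFun j l) → i ≡ j
finToFun-injective         zero    {zero} {zero} _   = refl
finToFun-injective {m} (suc n) eq = remQuot-injective m (m ^ n) (cong₂ _,_ (eq zero) (finToFun-injective n (eq ∘ suc)))

-- Bijective base-2 numeration, least significant digit first.
code : List Bool → ℕ
code []          = 0
code (false ∷ l) = 1 + 2 * code l
code (true  ∷ l) = 2 + 2 * code l

code-injective : ∀ l l′ → code l ≡ code l′ → l ≡ l′
code-injective []          []           _  = refl
code-injective []          (false ∷ l′) ()
code-injective []          (true  ∷ l′) ()
code-injective (false ∷ l) []           ()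
code-injective (true  ∷ l) []           ()
code-injective (false ∷ l) (false ∷ l′) eq = cong (false ∷_) (code-injective l l′ (ℕ.*-cancelˡ-≡ _ _ 2 (ℕ.suc-injective eq)))
code-injective (true  ∷ l) (true  ∷ l′) eq = cong (true ∷_) (code-injective l l′ (ℕ.*-cancelˡ-≡ _ _ 2 (ℕ.suc-injective (ℕ.suc-injective eq))))
code-injective (false ∷ l) (true  ∷ l′) eq = contradiction (sym (ℕ.suc-injective eq)) (ℕ.even≢odd (code l) (code l′) ∘ sym)
code-injective (true  ∷ l) (false ∷ l′) eq = contradiction (ℕ.suc-injective eq) (ℕ.even≢odd (code l′) (code l) ∘ sym)

-- The largest code of a given length, that of the all-`true` string, attains equality. The summand
-- 2 makes the bound double exactly in the `true` case.
code-bound : ∀ l → 2 + code l ≤ 2 ^ suc (length l)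
code-bound []      = ≤-refl
code-bound (b ∷ l) = ≤-trans (case b) (ℕ.*-monoʳ-≤ 2 (code-bound l))
  where
  case : ∀ b → 2 + code (b ∷ l) ≤ 2 * (2 + code l)
  case false = ≤-trans (ℕ.n≤1+n _) (case true)
  case true  = ≤-reflexive (sym (ℕ.*-distribˡ-+ 2 2 (code l)))

n<2^n : ∀ n → n < 2 ^ n
n<2^n zero    = ≤-refl
n<2^n (suc n) = ≤-trans (+-mono-≤ (ℕ.m^n>0 2 n) (n<2^n n)) (+-mono-≤ (≤-refl {2 ^ n}) (ℕ.m≤m+n _ 0))

-- Memories have varying lengths, so all strings shorter than `B` are counted together: their codes
-- lie below `2 ^ B ∸ 1`, which leaves too few for `n` distinct values.
injective⇒∃-long : ∀ {n} B → 2 ^ B ≤ n → (f : Fin n → List Bool) → (∀ {i j} → f i ≡ f j → i ≡ j) → ∃[ i ] B ≤ length (f i)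
injective⇒∃-long B 2^B≤n f f-inj with any? (λ i → B ℕ.≤? length (f i))
... | yes long = long
... | no ¬long =
  let i , j , i<j , eq = pigeonhole fewer (λ i → fromℕ< (bound i))
  in contradiction (f-inj (code-injective (f i) (f j) (fromℕ<-injective _ _ (bound i) (bound j) eq))) (Fin.<⇒≢ i<j)
  where
  fewer : 2 ^ B ∸ 1 < _
  fewer = ℕ.<-≤-trans (ℕ.∸-monoʳ-< z<s (ℕ.m^n>0 2 B)) 2^B≤n

  bound : ∀ i → code (f i) < 2 ^ B ∸ 1
  bound i = ℕ.∸-monoˡ-≤ 1 (≤-trans (code-bound (f i)) (ℕ.^-monoʳ-≤ 2 (ℕ.≰⇒> (¬long ∘ (i ,_)))))

-- Cuts of a single star.

-- The cost incurred by a star with edge costs c when its centre lies on side b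
-- of a cut with terminals S on side `true`.
cutValue : ∀ {k} → (Fin k → ℕ) → Subset k → Bool → ℕ
cutValue c S b = sum λ t → if lookup S t xor b then c t else 0

-- Swapping the sides of all terminals cuts the same edges as moving the centre across. This handles
-- the second alternative of `Separates`.
cutValue-∁ : ∀ {k} (c : Fin k → ℕ) S b → cutValue c (∁ S) b ≡ cutValue c S (not b)
cutValue-∁ c S b = sum-cong-≗ λ t → cong (if_then c t else 0) (begin
  lookup (∁ S) t xor b     ≡⟨ cong (_xor b) (lookup-map t not S) ⟩
  not (lookup S t) xor b   ≡⟨ not-distribˡ-xor (lookup S t) b ⟨
  not (lookup S t xor b)   ≡⟨ not-distribʳ-xor (lookup S t) b ⟩
  lookup S t xor not b     ∎)
  where open ≡-Reasoning

-- Each edge is cut for exactly one of the two positions of the centre.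
cutValue-+ : ∀ {k} (c : Fin k → ℕ) S → cutValue c S false + cutValue c S true ≡ sum c
cutValue-+ c S = trans (sym (∑-distrib-+ (λ t → if lookup S t xor false then c t else 0) _)) (sum-cong-≗ λ t → split (lookup S t))
  where
  split : ∀ b {x} → (if b xor false then x else 0) + (if b xor true then x else 0) ≡ x
  split false = refl
  split true  = ℕ.+-identityʳ _

starMin : ∀ {k} → (Fin k → ℕ) → Subset k → ℕ
starMin c S = cutValue c S false ⊓ cutValue c S true

starMin≤cutValue : ∀ {k} (c : Fin k → ℕ) S b → starMin c S ≤ cutValue c S b
starMin≤cutValue c S false = ℕ.m⊓n≤m _ _
starMin≤cutValue c S true  = ℕ.m⊓n≤n _ _

bestSide : ∀ {k} (c : Fin k → ℕ) S → ∃[ b ] cutValue c S b ≡ starMin c S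
bestSide c S with ℕ.≤-total (cutValue c S false) (cutValue c S true)
... | inj₁ ≤ = false , sym (ℕ.m≤n⇒m⊓n≡m ≤)
... | inj₂ ≥ = true  , sym (ℕ.m≥n⇒m⊓n≡n ≥)

-- Minimum cuts of a union of stars.

-- D stars, each with an edge to every terminal, plus `pad` isolated vertices.
module StarNetwork (k D pad : ℕ) {C₀ : ℕ} (c : Fin D → Fin k → ℕ)
                   (c-lower : ∀ u t → 1 ≤ c u t)
                   (c-upper : ∀ u t → c u t ≤ (k + (D + pad)) ^ C₀) where

  centre : Fin D → Fin (k + (D + pad))
  centre u = k ↑ʳ (u ↑ˡ pad)

  edge : Fin D × Fin k → Fin (k + (D + pad)) × Fin (k + (D + pad))
  edge (u , t) = t ↑ˡ (D + pad) , centre u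

  edge-injective : ∀ {p q} → edge p ≡ edge q → p ≡ q
  edge-injective eq = cong₂ _,_
    (↑ˡ-injective pad _ _ (↑ʳ-injective k _ _ (,-injectiveʳ eq)))
    (↑ˡ-injective (D + pad) _ _ (,-injectiveˡ eq))

  network : Network k C₀
  network = record
    { graph = record
      { #vertices     = k + (D + pad)
      ; #edges        = D * k
      ; endpoints     = edge ∘ remQuot k
      ; ordered       = λ e → edge-ordered (remQuot k e)
      ; endpoints-inj = remQuot-injective D k ∘ edge-injective
      }
    ; cost         = λ e → let (u , t) = remQuot k e in c u t
    ; cost-lower   = λ e → c-lower _ _
    ; cost-upper   = λ e → c-upper _ _
    ; terminal     = _↑ˡ (D + pad)
    ; terminal-inj = ↑ˡ-injective (D + pad) _ _
    }
    where
    edge-ordered : ∀ p → proj₁ (edge p) Fin.< proj₂ (edge p)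
    edge-ordered (u , t) = begin-strict
      toℕ (t ↑ˡ (D + pad))  ≡⟨ toℕ-↑ˡ t (D + pad) ⟩
      toℕ t                 <⟨ toℕ<n t ⟩
      k                     ≤⟨ ℕ.m≤m+n k _ ⟩
      k + toℕ (u ↑ˡ pad)    ≡⟨ toℕ-↑ʳ k (u ↑ˡ pad) ⟨
      toℕ (centre u)        ∎
      where open ℕ.≤-Reasoning

  -- Every edge joins a terminal to exactly one centre, so the edges can be grouped by centre.
  cutCost≡∑cutValue : ∀ W → cutCost network W ≡ sum (λ u → cutValue (c u) (terminalsIn network W) (lookup W (centre u)))
  cutCost≡∑cutValue W = trans (sum-combine D _) (sum-cong-≗ λ u → sum-cong-≗ λ t → term u t)
    where
    -- Taking the pair as one argument lets a single `cong` along `remQuot-combine` act on terminal,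
    -- centre and cost at once.
    pay : Bool → Fin D × Fin k → ℕ
    pay b (u , t) = if b xor lookup W (centre u) then c u t else 0

    term : ∀ u t → pay (lookup W (proj₂ (remQuot {D} k (combine u t)) ↑ˡ (D + pad))) (remQuot {D} k (combine u t))
                 ≡ pay (lookup (terminalsIn network W) t) (u , t)
    term u t = trans
      (cong (λ p → pay (lookup W (proj₂ p ↑ˡ (D + pad))) p) (remQuot-combine u t))
      (cong (λ b → pay b (u , t)) (sym (lookup∘tabulate _ t)))

  -- Once the terminals are placed, the centres choose their sides independently, so the minimum of
  -- the sum is the sum of the minima.
  ∑starMin-isMinCut : ∀ S → IsMinCut network S (sum λ u → starMin (c u) S)
  ∑starMin-isMinCut S = (W , inj₁ W∩Q≡S , W-cost) , lower
    where
    side : Fin D → Bool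
    side u = proj₁ (bestSide (c u) S)

    W : Subset (k + (D + pad))
    W = S ++ (tabulate side ++ replicate pad outside)

    W∩Q≡S : terminalsIn network W ≡ S
    W∩Q≡S = trans (tabulate-cong (lookup-++ˡ S _)) (tabulate∘lookup S)

    W-centre : ∀ u → lookup W (centre u) ≡ side u
    W-centre u = trans (lookup-++ʳ S _ _) (trans (lookup-++ˡ (tabulate side) _ u) (lookup∘tabulate side u))

    W-cost : cutCost network W ≡ sum λ u → starMin (c u) S
    W-cost = trans (cutCost≡∑cutValue W) (sum-cong-≗ λ u →
      trans (cong₂ (cutValue (c u)) W∩Q≡S (W-centre u)) (proj₂ (bestSide (c u) S)))

    lower : ∀ W′ → Separates network W′ S → sum (λ u → starMin (c u) S) ≤ cutCost network W′
    lower W′ sep = ≤-trans (sum-mono-≤ (bound sep)) (≤-reflexive (sym (cutCost≡∑cutValue W′)))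
      where
      bound : Separates network W′ S → ∀ u → starMin (c u) S ≤ cutValue (c u) (terminalsIn network W′) (lookup W′ (centre u))
      bound (inj₁ eq) u rewrite eq = starMin≤cutValue (c u) S _
      bound (inj₂ eq) u rewrite eq | cutValue-∁ (c u) S (lookup W′ (centre u)) = starMin≤cutValue (c u) S _

isMinCut-unique : ∀ {k C₀} (N : Network k C₀) {S v w} → IsMinCut N S v → IsMinCut N S w → v ≡ w
isMinCut-unique N ((V , V-sep , refl) , v≤) ((W , W-sep , refl) , w≤) = ≤-antisym (v≤ W W-sep) (w≤ V V-sep)

-- Weights detecting inclusion of subsets.

weight : ∀ {m} → ℕ → Subset m → Fin m → ℕ
weight L U i = if lookup U i then L else 1

-- With the centre on side `true`, the cut edges lead to terminals outside `V`. If `U ⊆ V` these are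
-- also outside `U` and cost 1 each.
⊆⇒cutValue≤ : ∀ {m} L (U V : Subset m) → U ⊆ V → cutValue (weight L U) V true ≤ m
⊆⇒cutValue≤ L []            []            U⊆V = z≤n
⊆⇒cutValue≤ L (outside ∷ U) (outside ∷ V) U⊆V = s≤s (⊆⇒cutValue≤ L U V (drop-∷-⊆ U⊆V))
⊆⇒cutValue≤ L (u ∷ U)       (inside ∷ V)  U⊆V = ℕ.m≤n⇒m≤1+n (⊆⇒cutValue≤ L U V (drop-∷-⊆ U⊆V))
⊆⇒cutValue≤ L (inside ∷ U)  (outside ∷ V) U⊆V with () ← U⊆V here

⊈⇒≤cutValue : ∀ {m} L (U V : Subset m) → ¬ U ⊆ V → L ≤ cutValue (weight L U) V true
⊈⇒≤cutValue L []            []            U⊈V = contradiction (λ ()) U⊈V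
⊈⇒≤cutValue L (outside ∷ U) (v ∷ V)       U⊈V = ≤-trans (⊈⇒≤cutValue L U V (U⊈V ∘ out⊆)) (ℕ.m≤n+m _ _)
⊈⇒≤cutValue L (inside ∷ U)  (inside ∷ V)  U⊈V = ⊈⇒≤cutValue L U V (U⊈V ∘ in⊆in)
⊈⇒≤cutValue L (inside ∷ U)  (outside ∷ V) U⊈V = ℕ.m≤m+n L _

⊆∧≢⇒size< : ∀ {m} (U V : Subset m) → U ⊆ V → U ≢ V → size U < size V
⊆∧≢⇒size< []            []            U⊆V U≢V = contradiction refl U≢V
⊆∧≢⇒size< (outside ∷ U) (outside ∷ V) U⊆V U≢V = ⊆∧≢⇒size< U V (drop-∷-⊆ U⊆V) (U≢V ∘ cong (outside ∷_))
⊆∧≢⇒size< (inside ∷ U)  (inside ∷ V)  U⊆V U≢V = s<s (⊆∧≢⇒size< U V (drop-∷-⊆ U⊆V) (U≢V ∘ cong (inside ∷_)))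
⊆∧≢⇒size< (outside ∷ U) (inside ∷ V)  U⊆V U≢V = s≤s (p⊆q⇒∣p∣≤∣q∣ (drop-∷-⊆ U⊆V))
⊆∧≢⇒size< (inside ∷ U)  (outside ∷ V) U⊆V U≢V with () ← U⊆V here

nthSubset : ∀ m → Fin (2 ^ m) → Subset m
nthSubset m u = tabulate (Inverse.to 2↔Bool ∘ finToFun u)

nthSubset-injective : ∀ m {u v} → nthSubset m u ≡ nthSubset m v → u ≡ v
nthSubset-injective m {u} {v} eq = finToFun-injective m λ i → Injection.injective (↔⇒↣ 2↔Bool) (begin
  Inverse.to 2↔Bool (finToFun u i) ≡⟨ lookup∘tabulate _ i ⟨
  lookup (nthSubset m u) i         ≡⟨ cong (λ U → lookup U i) eq ⟩
  lookup (nthSubset m v) i         ≡⟨ lookup∘tabulate _ i ⟩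
  Inverse.to 2↔Bool (finToFun v i) ∎)
  where open ≡-Reasoning

-- The hard networks and their minimum cuts.

module HardNetworks (m pad : ℕ) where

  k D n L : ℕ
  k = 2 + m
  D = 2 ^ m
  n = k + (D + pad)
  L = m + m + n

  -- The first cost makes `false` the cheaper side of the centre as long as the
  -- ordinary terminals outside V cost at least L, that is, unless U ⊆ V; L is
  -- large enough for `true` to be the cheaper side if they cost at most m.
  starCost : ℕ → Subset m → Fin k → ℕ
  starCost x U zero          = sum (weight L U) + x
  starCost x U (suc zero)    = L
  starCost x U (suc (suc i)) = weight L U i

  separating : Subset m → Subset k
  separating V = outside ∷ inside ∷ V

  -- Sides `true` and `false` cost `sum (weight L U) + x + σ̄` and `L + σ`. As the weights sum to
  -- `σ + σ̄`, side `true` wins when twice `σ̄` plus `x` is at most `L`; this is why `L` is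
  -- `m + m + n`.
  starMin-⊆ : ∀ {x} U V → x ≤ n → U ⊆ V →
              starMin (starCost x U) (separating V) ≡ sum (weight L U) + x + cutValue (weight L U) V true
  starMin-⊆ {x} U V x≤n U⊆V = ℕ.m≥n⇒m⊓n≡n (begin
    sum (weight L U) + x + σ̄ ≡⟨ cong (λ s → s + x + σ̄) (cutValue-+ (weight L U) V) ⟨
    σ + σ̄ + x + σ̄            ≡⟨ rearrange σ σ̄ x ⟩
    σ̄ + σ̄ + x + σ            ≤⟨ ℕ.+-monoˡ-≤ σ (+-mono-≤ (+-mono-≤ σ̄≤m σ̄≤m) x≤n) ⟩
    L + σ                    ∎)
    where
    open ℕ.≤-Reasoning
    σ = cutValue (weight L U) V false
    σ̄ = cutValue (weight L U) V true
    σ̄≤m : σ̄ ≤ m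
    σ̄≤m = ⊆⇒cutValue≤ L U V U⊆V
    rearrange : ∀ a b c → a + b + c + b ≡ b + b + c + a
    rearrange = solve-∀

  -- Here `σ̄` alone reaches `L`, so side `false` wins whatever `x` is, and the minimum does not
  -- depend on `x`.
  starMin-⊈ : ∀ {x} U V → ¬ U ⊆ V →
              starMin (starCost x U) (separating V) ≡ L + cutValue (weight L U) V false
  starMin-⊈ {x} U V U⊈V = ℕ.m≤n⇒m⊓n≡m (begin
    L + σ                    ≤⟨ ℕ.+-monoˡ-≤ σ (⊈⇒≤cutValue L U V U⊈V) ⟩
    σ̄ + σ                    ≡⟨ ℕ.+-comm σ̄ σ ⟩
    σ + σ̄                    ≡⟨ cutValue-+ (weight L U) V ⟩
    sum (weight L U)         ≤⟨ ℕ.m≤m+n _ x ⟩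
    sum (weight L U) + x     ≤⟨ ℕ.m≤m+n _ σ̄ ⟩
    sum (weight L U) + x + σ̄ ∎)
    where
    open ℕ.≤-Reasoning
    σ = cutValue (weight L U) V false
    σ̄ = cutValue (weight L U) V true

  -- Bounds on the edge costs.

  1≤L : 1 ≤ L
  1≤L = ≤-trans (s≤s z≤n) (ℕ.m≤n+m n (m + m))

  1≤weight : ∀ (U : Subset m) i → 1 ≤ weight L U i
  1≤weight U i with lookup U i
  ... | true  = 1≤L
  ... | false = ≤-refl

  weight≤L : ∀ (U : Subset m) i → weight L U i ≤ L
  weight≤L U i with lookup U i
  ... | true  = ≤-refl
  ... | false = 1≤L

  1+2m≤n : suc (m + m) ≤ n
  1+2m≤n = s≤s (ℕ.m≤n⇒m≤1+n (ℕ.+-monoʳ-≤ m (≤-trans (ℕ.<⇒≤ (n<2^n m)) (ℕ.m≤m+n D pad))))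

  -- Bounds the edge to the first special terminal, whose cost is at most `m` weights plus a
  -- perturbation. Since `L` is at most `n + n`, the exponent 2 suffices.
  mL+n≤n² : m * L + n ≤ n ^ 2
  mL+n≤n² = begin
    m * (m + m + n) + n ≤⟨ ℕ.+-monoˡ-≤ n (ℕ.*-monoʳ-≤ m (ℕ.+-monoˡ-≤ n (ℕ.<⇒≤ 1+2m≤n))) ⟩
    m * (n + n) + n     ≡⟨ factor m n ⟩
    suc (m + m) * n     ≤⟨ ℕ.*-monoˡ-≤ n 1+2m≤n ⟩
    n * n               ≡⟨ cong (n *_) (ℕ.*-identityʳ n) ⟨
    n ^ 2               ∎
    where
    open ℕ.≤-Reasoning
    factor : ∀ a b → a * (b + b) + b ≡ suc (a + a) * b
    factor = solve-∀

  L≤n² : L ≤ n ^ 2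
  L≤n² = begin
    m + m + n           ≤⟨ ℕ.+-monoˡ-≤ n (ℕ.m≤m*n (m + m) n) ⟩
    (m + m) * n + n     ≡⟨ ℕ.+-comm _ n ⟩
    suc (m + m) * n     ≤⟨ ℕ.*-monoˡ-≤ n 1+2m≤n ⟩
    n * n               ≡⟨ cong (n *_) (ℕ.*-identityʳ n) ⟨
    n ^ 2               ∎
    where open ℕ.≤-Reasoning

  starCost-lower : ∀ {x} U t → 1 ≤ x → 1 ≤ starCost x U t
  starCost-lower U zero          1≤x = ≤-trans 1≤x (ℕ.m≤n+m _ _)
  starCost-lower U (suc zero)    1≤x = 1≤L
  starCost-lower U (suc (suc i)) 1≤x = 1≤weight U i

  starCost-upper : ∀ {x} U t → x ≤ n → starCost x U t ≤ n ^ 2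
  starCost-upper U zero          x≤n = ≤-trans (+-mono-≤ (sum-≤-* (weight≤L U)) x≤n) mL+n≤n²
  starCost-upper U (suc zero)    x≤n = L≤n²
  starCost-upper U (suc (suc i)) x≤n = ≤-trans (weight≤L U i) L≤n²

  -- Recovering the perturbations from the memory.

  costs : (Fin D → Fin n) → Fin D → Fin k → ℕ
  -- The successor makes the perturbation range over 1 to `n`, as the two cost bounds require.
  costs x u = starCost (suc (toℕ (x u))) (nthSubset m u)

  module _ (x : Fin D → Fin n) where
    open StarNetwork k D pad {2} (costs x) (λ u t → starCost-lower _ t (s≤s z≤n)) (λ u t → starCost-upper _ t (toℕ<n (x u))) public

  costs-determined : (x y : Fin D → Fin n) →
                     (∀ V → sum (λ u → starMin (costs x u) (separating V)) ≡ sum (λ u → starMin (costs y u) (separating V))) →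
                     ∀ u → x u ≡ y u
  costs-determined x y eq u = go u (<-wellFounded _)
    where
    go : ∀ u → Acc _<_ (size (nthSubset m u)) → x u ≡ y u
    go u (acc rec) = toℕ-injective (ℕ.suc-injective (ℕ.+-cancelˡ-≡ (sum (weight L U)) _ _ (ℕ.+-cancelʳ-≡ σ̄ _ _ (begin
      sum (weight L U) + suc (toℕ (x u)) + σ̄ ≡⟨ starMin-⊆ U U (toℕ<n (x u)) ⊆-refl ⟨
      -- The query for `U` itself is used: the star of `U` is then the only one whose contribution
      -- is still unknown.
      starMin (costs x u) (separating U)     ≡⟨ sum-cancel-except _ _ u others (eq U) ⟩
      starMin (costs y u) (separating U)     ≡⟨ starMin-⊆ U U (toℕ<n (y u)) ⊆-refl ⟩
      sum (weight L U) + suc (toℕ (y u)) + σ̄ ∎))))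
      where
      open ≡-Reasoning
      U = nthSubset m u
      σ̄ = cutValue (weight L U) U true
      others : ∀ v → v ≢ u → starMin (costs x v) (separating U) ≡ starMin (costs y v) (separating U)
      -- A subset of `U` other than `U` is smaller, so the induction applies; for a non-subset the
      -- contribution is independent of the perturbation.
      others v v≢u with nthSubset m v ⊆? U
      ... | yes V⊆U = cong (λ z → starMin (starCost (suc (toℕ z)) (nthSubset m v)) (separating U))
                           (go v (rec (⊆∧≢⇒size< _ U V⊆U (v≢u ∘ nthSubset-injective m))))
      ... | no  V⊈U = trans (starMin-⊈ _ U V⊈U) (sym (starMin-⊈ _ U V⊈U))

  preprocess-injective : (A : TCScheme k 2) (x y : Fin D → Fin n) →
                         TCScheme.preprocess A (network x) ≡ TCScheme.preprocess A (network y) → ∀ u → x u ≡ y u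
  preprocess-injective A x y eq = costs-determined x y λ V →
    let S = separating V in
    -- The first two entries of `separating V` differ, so it is neither `⊥` nor `⊤` and the absurd
    -- patterns apply.
    trans (isMinCut-unique (network x) (∑starMin-isMinCut x S) (correct (network x) S (λ ()) (λ ())))
          (isMinCut-unique (network y) (subst (λ M → IsMinCut (network y) S (query S M)) (sym eq) (correct (network y) S (λ ()) (λ ()))) (∑starMin-isMinCut y S))
    where open TCScheme A

  -- There are `n ^ D` choices of perturbations, all with distinct memories, and `n ^ D` is at least
  -- `2 ^ (w * D)`.
  memory-bits : (A : TCScheme k 2) → ∀ w → 2 ^ w ≤ n → ∃[ N ] Network.#vertices N ≡ n × w * D ≤ length (TCScheme.preprocess A N)
  memory-bits A w 2^w≤n =
    let i , long = injective⇒∃-long (w * D) enough (λ i → TCScheme.preprocess A (network (finToFun i)))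
                     (finToFun-injective D ∘ preprocess-injective A _ _)
    in network (finToFun i) , refl , long
    where
    enough : 2 ^ (w * D) ≤ n ^ D
    enough = ≤-trans (≤-reflexive (sym (ℕ.^-*-assoc 2 w D))) (ℕ.^-monoˡ-≤ D 2^w≤n)

-- Choice of the constants and the final estimate.

theorem1p4 : ∃[ γ ] ∃[ C₀ ] (0ℚ ℚ.< γ) × (1 ≤ C₀) × (∀ (k : ℕ) → k > 5 → (A : TCScheme k C₀) → ∃[ N ] MemoryAtLeast γ k (wordSize N) (TCScheme.preprocess A N))
theorem1p4 = ℚ.½ , 2 , ℚ.*<* (ℤ.+<+ (s≤s z≤n)) , s≤s z≤n , bound
  where
  -- The padding makes the number of vertices exactly 2 ^ k, so that a word has k bits.
  bound : ∀ k → k > 5 → (A : TCScheme k 2) → ∃[ N ] MemoryAtLeast ℚ.½ k (wordSize N) (TCScheme.preprocess A N)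
  bound (suc (suc m)) (s≤s (s≤s m>3)) A =
    let N , #N≡n , long = memory-bits A k (≤-reflexive (sym n≡2^k))
        w≡k = trans (cong ⌈log₂_⌉ (trans #N≡n n≡2^k)) (⌈log₂2^n⌉≡n k)
    in N , (begin
      2 ^ (1 * k) * wordSize N ^ 2                ≡⟨ cong₂ (λ e w → 2 ^ e * w ^ 2) (ℕ.*-identityˡ k) w≡k ⟩
      -- With γ one half, both sides are squared. The memory has at least `D` words of `k` bits, and
      -- `D` squared is `2 ^ (m * 2)`, at least `2 ^ k`.
      2 ^ k * k ^ 2                               ≤⟨ ℕ.*-monoˡ-≤ (k ^ 2) (ℕ.^-monoʳ-≤ 2 k≤m*2) ⟩
      2 ^ (m * 2) * k ^ 2                         ≡⟨ cong (_* k ^ 2) (ℕ.^-*-assoc 2 m 2) ⟨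
      D ^ 2 * k ^ 2                               ≡⟨ square-* D k ⟩
      (k * D) ^ 2                                 ≤⟨ ℕ.^-monoˡ-≤ 2 long ⟩
      length (TCScheme.preprocess A N) ^ 2        ∎)
    where
    pad = 2 ^ (2 + m) ∸ (2 + m + 2 ^ m)
    open HardNetworks m pad
    open ℕ.≤-Reasoning

    -- Ensures that the truncated subtraction in `pad` is exact: `k` is at most `D + D`, and `2 ^ k`
    -- is four times `D`.
    k+D≤2^k : k + D ≤ 2 ^ k
    k+D≤2^k = begin
      suc (suc m) + D           ≤⟨ ℕ.+-monoˡ-≤ D (+-mono-≤ (ℕ.m^n>0 2 m) (n<2^n m)) ⟩
      D + D + D                 ≤⟨ ℕ.m≤m+n _ D ⟩
      D + D + D + D             ≡⟨ fourfold D ⟩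
      2 ^ k                     ∎
      where
      fourfold : ∀ d → d + d + d + d ≡ 2 * (2 * d)
      fourfold = solve-∀

    n≡2^k : n ≡ 2 ^ k
    n≡2^k = trans (sym (ℕ.+-assoc k D pad)) (ℕ.m+[n∸m]≡n k+D≤2^k)

    k≤m*2 : k ≤ m * 2
    k≤m*2 = begin
      2 + m ≤⟨ ℕ.+-monoˡ-≤ m (ℕ.<⇒≤ (ℕ.<-trans (s<s (s<s z<s)) m>3)) ⟩
      m + m ≡⟨ double m ⟩
      m * 2 ∎
      where
      double : ∀ a → a + a ≡ a * 2
      double = solve-∀

    square-* : ∀ a b → a * (a * 1) * (b * (b * 1)) ≡ b * a * (b * a * 1)
    square-* = solve-∀
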